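{- If $S \subseteq \mathbb{Z}$ is a set of integers with $|S| = 4$, then $d_p(S) \ge \frac{1}{7}$. Furthermore, $d_p(\{0,1,4,6\}) = \frac{1}{7}$, so the set $\{0,1,4,6\}$ achieves the minimum packing density among all sets of four integers.
   Context: For $S \subseteq \mathbb{Z}$ and $a \in \mathbb{Z}$, write $S + a = \{s + a : s \in S\}$. A set $A \subseteq \mathbb{Z}$ is called $S$-packing if for all $a_1, a_2 \in A$ with $a_1 \neq a_2$, the sets $S + a_1$ and $S + a_2$ are disjoint. The upper density of $A \subseteq \mathbb{Z}$ is $\overline{d}(A) = \limsup_{n\to\infty} \frac{|A \cap [-n,n]|}{2n+1}$. The packing density of $S$ is $d_p(S) = \sup\{\overline{d}(A) : A \text{ is } S\text{ -packing}\}$. -}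

module Defs where

open import Data.Nat using (ℕ; suc; _*_)
open import Data.Integer as ℤ using (ℤ; +_; -_)
open import Data.Rational as ℚ using (ℚ; 0ℚ; _/_)
open import Data.List using (List; []; _∷_; length)
open import Data.List.Membership.Propositional using (_∈_)
open import Data.List.Relation.Unary.All using (All)
open import Data.List.Relation.Unary.Unique.Propositional using (Unique)
open import Data.Product using (Σ; ∃; _×_)
open import Relation.Binary.PropositionalEquality using (_≡_; _≢_)

Subset : Set₁
Subset = ℤ → Set

-- A finite set S ⊆ ℤ is a duplicate-free list of its elements.
-- S + a₁ and S + a₂ disjoint: no s, t ∈ S with s + a₁ = t + a₂.
IsPacking : List ℤ → Subset → Set
IsPacking S A = ∀ a₁ a₂ → A a₁ → A a₂ → a₁ ≢ a₂ →
                ∀ s t → s ∈ S → t ∈ S → s ℤ.+ a₁ ≢ t ℤ.+ a₂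

AtLeast : Subset → ℕ → ℕ → Set
AtLeast A n k = Σ (List ℤ) λ xs → Unique xs × length xs ≡ k ×
                All (λ x → A x × (- (+ n)) ℤ.≤ x × x ℤ.≤ + n) xs

ratio : ℕ → ℕ → ℚ
ratio k n = (+ k) / suc (2 * n)

-- limsup_n |A ∩ [-n,n]|/(2n+1) ≥ c
UpperDensityGE : Subset → ℚ → Set
UpperDensityGE A c = ∀ δ → 0ℚ ℚ.< δ → ∀ N → Σ ℕ λ n → N Data.Nat.≤ n ×
                     Σ ℕ λ k → AtLeast A n k × (c ℚ.- δ) ℚ.< ratio k n

-- limsup_n |A ∩ [-n,n]|/(2n+1) ≤ c
UpperDensityLE : Subset → ℚ → Set
UpperDensityLE A c = ∀ δ → 0ℚ ℚ.< δ → Σ ℕ λ N → ∀ n → N Data.Nat.≤ n →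
                     ∀ k → AtLeast A n k → ratio k n ℚ.< c ℚ.+ δ

-- d_p(S) ≥ c  (sup over S-packing A of upper density ≥ c)
PackingDensityGE : List ℤ → ℚ → Set₁
PackingDensityGE S c = ∀ δ → 0ℚ ℚ.< δ →
                       Σ Subset λ A → IsPacking S A × UpperDensityGE A (c ℚ.- δ)

PackingDensityLE : List ℤ → ℚ → Set₁
PackingDensityLE S c = ∀ A → IsPacking S A → UpperDensityLE A c

PackingDensityEq : List ℤ → ℚ → Set₁
PackingDensityEq S c = PackingDensityGE S c × PackingDensityLE S c

S₀ : List ℤ
S₀ = + 0 ∷ + 1 ∷ + 4 ∷ + 6 ∷ []

{-# OPTIONS --safe #-}

-- Lower bound: a set of four integers has at most six positive differences d.
-- Scanning 0, 1, 2, … and keeping n unless n = a + d for some kept a, every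
-- number is kept or of the form a + d, so at least 1/7 of each initial segment
-- is kept.  The kept numbers, together with their mirror image pushed beyond
-- the largest difference, form a packing set of density at least 1/7.
-- Upper bound: the positive differences of {0,1,4,6} are exactly 1, …, 6, so
-- each block of seven consecutive integers meets a packing set at most once.
module Submission where

open import Defs
open import Data.Integer using (ℤ)
open import Data.Rational using (_/_)
open import Data.Integer using (+_)
open import Data.List using (List; length)
open import Data.List.Relation.Unary.Unique.Propositional using (Unique)
open import Data.Product using (_×_)
open import Relation.Binary.PropositionalEquality using (_≡_)

open import Data.Nat as ℕ using (ℕ; zero; suc; z≤n; s≤s; _∸_)
import Data.Nat.Properties as ℕP
import Data.Nat.DivMod as DM
open import Data.Nat.Tactic.RingSolver using (solve-∀)
open import Data.Integer as ℤ using (-[1+_]; ∣_∣; _⊖_; -_; +≤+; -≤+; +<+)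
import Data.Integer.Properties as ℤP
import Algebra.Properties.AbelianGroup ℤP.+-0-abelianGroup as ℤG
import Data.Integer.Tactic.RingSolver as ℤSolver
open import Data.Rational as ℚ using (ℚ; 0ℚ; mkℚ; toℚᵘ; *<*)
import Data.Rational.Properties as ℚP
open import Data.Rational.Unnormalised as ℚᵘ using (mkℚᵘ)
import Data.Rational.Unnormalised.Properties as ℚᵘP
import Data.Fin as Fin
import Data.Fin.Properties as FinP
open import Data.List using ([]; _∷_; _++_; map; lookup; upTo; cartesianProductWith)
import Data.List.Properties as ListP
open import Data.List.Extrema.Nat using (max; xs≤max)
open import Data.List.Membership.Propositional using (_∈_; _∉_; find)
open import Data.List.Membership.Propositional.Properties
open import Data.List.Membership.Setoid.Properties using (index-injective)
open import Data.List.Membership.DecPropositional ℕ._≟_ using (_∈?_)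
open import Data.List.Relation.Unary.All as All using (All; []; _∷_)
import Data.List.Relation.Unary.All.Properties as AllP
open import Data.List.Relation.Unary.AllPairs using ([]; _∷_)
open import Data.List.Relation.Unary.Any as Any using (Any; here; there; any?)
import Data.List.Relation.Unary.Unique.Propositional.Properties as UniqueP
open import Data.Product using (∃; _,_; proj₁; proj₂)
open import Data.Sum using (_⊎_; inj₁; inj₂)
open import Function using (_∘_)
open import Relation.Binary.PropositionalEquality
  using (_≢_; refl; sym; trans; cong; cong₂; subst; subst₂; setoid; module ≡-Reasoning)
open import Relation.Nullary using (¬_; yes; no; contradiction)

-- Counting with duplicate-free lists

lookup-injective : {A : Set} {xs : List A} → Unique xs →
                   ∀ {i j} → lookup xs i ≡ lookup xs j → i ≡ j
lookup-injective (x≢ ∷ u) {Fin.zero} {Fin.zero} eq = refl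
lookup-injective (x≢ ∷ u) {Fin.zero} {Fin.suc j} eq =
  contradiction eq (All.lookup x≢ (∈-lookup j))
lookup-injective (x≢ ∷ u) {Fin.suc i} {Fin.zero} eq =
  contradiction (sym eq) (All.lookup x≢ (∈-lookup i))
lookup-injective (x≢ ∷ u) {Fin.suc i} {Fin.suc j} eq =
  cong Fin.suc (lookup-injective u eq)

-- Sending a position in `xs` to a position of the same element in `ys` is injective: equal images
-- hold equal elements, and `xs` repeats none.
Unique-⊆⇒length-≤ : {A : Set} {xs ys : List A} → Unique xs →
                    (∀ {x} → x ∈ xs → x ∈ ys) → length xs ℕ.≤ length ys
Unique-⊆⇒length-≤ {xs = xs} u sub =
  FinP.injective⇒≤ {f = λ i → Any.index (sub (∈-lookup {xs = xs} i))}
    (λ eq → lookup-injective u (index-injective (setoid _) _ _ eq))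

Unique-map : {A B : Set} {P : A → Set} (f : A → B) →
             (∀ {x y} → P x → P y → x ≢ y → f x ≢ f y) →
             ∀ {xs} → All P xs → Unique xs → Unique (map f xs)
Unique-map f inj [] [] = []
Unique-map f inj (px ∷ pxs) (x≢ ∷ u) =
  AllP.map⁺ (All.zipWith (λ (py , ne) → inj px py ne) (pxs , x≢)) ∷ Unique-map f inj pxs u

length-cartesianProductWith : {A B C : Set} (f : A → B → C) (xs : List A) (ys : List B) →
  length (cartesianProductWith f xs ys) ≡ length xs ℕ.* length ys
length-cartesianProductWith f [] ys = refl
length-cartesianProductWith f (x ∷ xs) ys =
  trans (ListP.length-++ (map (f x) ys))
        (cong₂ ℕ._+_ (ListP.length-map (f x) ys) (length-cartesianProductWith f xs ys))

-- Comparison of fractions up to a positive error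

-- Dividing the first inequality by `suc b * suc e` leaves the error `C / (suc b * suc e)`. The
-- second makes it smaller than `1 / ↧ₙ δ`, which is at most `δ` because a positive numerator is at
-- least 1.
/-<-/+ : ∀ a b c e C δ → 0ℚ ℚ.< δ →
         a ℕ.* suc e ℕ.≤ c ℕ.* suc b ℕ.+ C →
         C ℕ.* ℚ.↧ₙ δ ℕ.< suc b ℕ.* suc e →
         (+ a) / suc b ℚ.< (+ c) / suc e ℚ.+ δ
/-<-/+ a b c e C (mkℚ (+ 0) _ _) (*<* (+<+ ())) _ _
/-<-/+ a b c e C (mkℚ -[1+ _ ] _ _) (*<* ()) _ _
/-<-/+ a b c e C δ@(mkℚ (+ suc p) q _) _ h Cq<be = ℚP.toℚᵘ-cancel-< (begin-strict
  toℚᵘ (+ a / suc b)             ≃⟨ ℚP.toℚᵘ-fromℚᵘ (mkℚᵘ (+ a) b) ⟩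
  mkℚᵘ (+ a) b                   <⟨ ℚᵘ.*<* (subst₂ ℤ._<_ lhs rhs (+<+ key)) ⟩
  mkℚᵘ (+ c) e ℚᵘ.+ toℚᵘ δ       ≃⟨ ℚᵘP.+-congˡ (toℚᵘ δ) (ℚP.toℚᵘ-fromℚᵘ (mkℚᵘ (+ c) e)) ⟨
  toℚᵘ (+ c / suc e) ℚᵘ.+ toℚᵘ δ ≃⟨ ℚP.toℚᵘ-homo-+ (+ c / suc e) δ ⟨
  toℚᵘ (+ c / suc e ℚ.+ δ)       ∎)
  where
  open ℚᵘP.≤-Reasoning
  lhs : + (a ℕ.* (suc e ℕ.* suc q)) ≡ + a ℤ.* + (suc e ℕ.* suc q)
  lhs = ℤP.pos-* a (suc e ℕ.* suc q)
  rhs : + ((c ℕ.* suc q ℕ.+ suc p ℕ.* suc e) ℕ.* suc b) ≡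
        (+ c ℤ.* + suc q ℤ.+ + suc p ℤ.* + suc e) ℤ.* + suc b
  rhs = trans (ℤP.pos-* (c ℕ.* suc q ℕ.+ suc p ℕ.* suc e) (suc b))
              (cong₂ (λ x y → (x ℤ.+ y) ℤ.* + suc b) (ℤP.pos-* c (suc q)) (ℤP.pos-* (suc p) (suc e)))
  regroup : ∀ b c e p q → c ℕ.* b ℕ.* q ℕ.+ p ℕ.* (b ℕ.* e) ≡ (c ℕ.* q ℕ.+ p ℕ.* e) ℕ.* b
  regroup = solve-∀
  key : a ℕ.* (suc e ℕ.* suc q) ℕ.< (c ℕ.* suc q ℕ.+ suc p ℕ.* suc e) ℕ.* suc b
  key = N.begin-strict
    a ℕ.* (suc e ℕ.* suc q)
      N.≡⟨ ℕP.*-assoc a (suc e) (suc q) ⟨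
    a ℕ.* suc e ℕ.* suc q
      N.≤⟨ ℕP.*-monoˡ-≤ (suc q) h ⟩
    (c ℕ.* suc b ℕ.+ C) ℕ.* suc q
      N.≡⟨ ℕP.*-distribʳ-+ (suc q) (c ℕ.* suc b) C ⟩
    c ℕ.* suc b ℕ.* suc q ℕ.+ C ℕ.* suc q
      N.<⟨ ℕP.+-monoʳ-< (c ℕ.* suc b ℕ.* suc q) Cq<be ⟩
    c ℕ.* suc b ℕ.* suc q ℕ.+ suc b ℕ.* suc e
      N.≤⟨ ℕP.+-monoʳ-≤ (c ℕ.* suc b ℕ.* suc q) (ℕP.m≤n*m (suc b ℕ.* suc e) (suc p)) ⟩
    c ℕ.* suc b ℕ.* suc q ℕ.+ suc p ℕ.* (suc b ℕ.* suc e)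
      N.≡⟨ regroup (suc b) c (suc e) (suc p) (suc q) ⟩
    (c ℕ.* suc q ℕ.+ suc p ℕ.* suc e) ℕ.* suc b N.∎
    where module N = ℕP.≤-Reasoning

p-ε<p : ∀ p {ε} → 0ℚ ℚ.< ε → p ℚ.- ε ℚ.< p
p-ε<p p ε>0 = subst (p ℚ.- _ ℚ.<_) (ℚP.+-identityʳ p) (ℚP.+-monoʳ-< p (ℚP.neg-antimono-< ε>0))

p<r+δ⇒p-δ<r : ∀ {p} r δ → p ℚ.< r ℚ.+ δ → p ℚ.- δ ℚ.< r
p<r+δ⇒p-δ<r {p} r δ h = subst (p ℚ.- δ ℚ.<_) r+δ-δ≡r (ℚP.+-monoˡ-< (ℚ.- δ) h)
  where
  r+δ-δ≡r : r ℚ.+ δ ℚ.- δ ≡ r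
  r+δ-δ≡r = trans (ℚP.+-assoc r δ (ℚ.- δ))
                  (trans (cong (r ℚ.+_) (ℚP.+-inverseʳ δ)) (ℚP.+-identityʳ r))

-- The greedy set avoiding prescribed differences

module Greedy (D : List ℕ) where

  -- Used only with `greedy n`, whose entries lie below `n`, so the truncated `n ∸ a` is the true
  -- difference.
  Hit : ℕ → List ℕ → Set
  Hit n = Any (λ a → n ∸ a ∈ D)

  greedy : ℕ → List ℕ
  greedy zero = []
  greedy (suc n) with any? (λ a → (n ∸ a) ∈? D) (greedy n)
  ... | yes _ = greedy n
  ... | no  _ = n ∷ greedy n

  -- Stage `suc n` is where `n` is decided; later stages only prepend larger numbers.
  G : ℕ → Set
  G n = n ∈ greedy (suc n)

  greedy-suc-⊇ : ∀ n {x} → x ∈ greedy n → x ∈ greedy (suc n)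
  greedy-suc-⊇ n x∈ with any? (λ a → (n ∸ a) ∈? D) (greedy n)
  ... | yes _ = x∈
  ... | no  _ = there x∈

  greedy-mono : ∀ {m n} → m ℕ.≤′ n → ∀ {x} → x ∈ greedy m → x ∈ greedy n
  greedy-mono ℕ.≤′-refl x∈ = x∈
  greedy-mono (ℕ.≤′-step {n} m≤n) x∈ = greedy-suc-⊇ n (greedy-mono m≤n x∈)

  ∈-greedy⇒< : ∀ n {x} → x ∈ greedy n → x ℕ.< n
  ∈-greedy⇒< (suc n) x∈ with any? (λ a → (n ∸ a) ∈? D) (greedy n) | x∈
  ... | yes _ | x∈′       = ℕP.m≤n⇒m≤1+n (∈-greedy⇒< n x∈′)
  ... | no  _ | here refl = ℕP.≤-refl
  ... | no  _ | there x∈′ = ℕP.m≤n⇒m≤1+n (∈-greedy⇒< n x∈′)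

  G⇒¬Hit : ∀ {n} → G n → ¬ Hit n (greedy n)
  G⇒¬Hit {n} Gn with any? (λ a → (n ∸ a) ∈? D) (greedy n) | Gn
  ... | yes _ | n∈ = contradiction (∈-greedy⇒< n n∈) (ℕP.<-irrefl refl)
  ... | no ¬h | _  = ¬h

  Hit⊎G : ∀ n → Hit n (greedy n) ⊎ G n
  Hit⊎G n with any? (λ a → (n ∸ a) ∈? D) (greedy n)
  ... | yes h = inj₁ h
  ... | no  _ = inj₂ (here refl)

  ∈-greedy⇒G : ∀ n {x} → x ∈ greedy n → G x
  ∈-greedy⇒G (suc n) x∈ with any? (λ a → (n ∸ a) ∈? D) (greedy n) in eq | x∈
  ... | yes _ | x∈′       = ∈-greedy⇒G n x∈′
  ... | no  _ | here refl rewrite eq = here refl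
  ... | no  _ | there x∈′ = ∈-greedy⇒G n x∈′

  greedy-unique : ∀ n → Unique (greedy n)
  greedy-unique zero = []
  greedy-unique (suc n) with any? (λ a → (n ∸ a) ∈? D) (greedy n)
  ... | yes _ = greedy-unique n
  ... | no  _ = All.tabulate (λ x∈ n≡x → ℕP.<⇒≢ (∈-greedy⇒< n x∈) (sym n≡x)) ∷ greedy-unique n

  -- When `b` is decided, `a` is already in the list, so a difference in `D` would have been a hit
  -- and `b` rejected.
  G-∸∉ : ∀ {a b} → G a → G b → a ℕ.< b → b ∸ a ∉ D
  G-∸∉ Ga Gb a<b b∸a∈ =
    G⇒¬Hit Gb (Any.map (λ { refl → b∸a∈ }) (greedy-mono (ℕP.≤⇒≤′ a<b) Ga))

  G-⊖∉ : ∀ {a b} → G a → G b → a ≢ b → ∣ a ⊖ b ∣ ∉ D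
  G-⊖∉ {a} {b} Ga Gb a≢b d∈ with ℕP.<-≤-connex a b
  ... | inj₁ a<b = G-∸∉ Ga Gb a<b (subst (_∈ D) (ℤP.∣⊖∣-≤ (ℕP.<⇒≤ a<b)) d∈)
  ... | inj₂ b≤a = G-∸∉ Gb Ga (ℕP.≤∧≢⇒< b≤a (a≢b ∘ sym))
                     (subst (_∈ D) (trans (ℤP.∣m⊖n∣≡∣n⊖m∣ a b) (ℤP.∣⊖∣-≤ b≤a)) d∈)

  -- The extra summand 0 covers the kept numbers; a rejected number is the entry that hit it plus an
  -- element of `D`.
  greedy-covers : ∀ {n x} → x ℕ.< n → x ∈ cartesianProductWith ℕ._+_ (greedy n) (0 ∷ D)
  greedy-covers {n} {x} x<n with Hit⊎G x
  ... | inj₂ Gx = subst (_∈ _) (ℕP.+-identityʳ x)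
                    (∈-cartesianProductWith⁺ ℕ._+_ (greedy-mono (ℕP.≤⇒≤′ x<n) Gx) (here refl))
  ... | inj₁ hit with find hit
  ... | a , a∈ , d∈ =
    subst (_∈ _) (ℕP.m+[n∸m]≡n (ℕP.<⇒≤ (∈-greedy⇒< x a∈)))
      (∈-cartesianProductWith⁺ ℕ._+_ (greedy-mono (ℕP.≤⇒≤′ (ℕP.<⇒≤ x<n)) a∈) (there d∈))

  greedy-length : ∀ n → n ℕ.≤ length (greedy n) ℕ.* suc (length D)
  greedy-length n = subst₂ ℕ._≤_ (ListP.length-upTo n)
    (length-cartesianProductWith ℕ._+_ (greedy n) (0 ∷ D))
    (Unique-⊆⇒length-≤ (UniqueP.upTo⁺ n) (λ x∈ → greedy-covers (∈-upTo⁻ x∈)))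

  -- The two-sided set and its density

  M : ℕ
  M = max 0 D

  -- Since density is measured on `[-n,n]`, the non-negative half alone would guarantee only half of
  -- the bound. The shift by `M` makes every difference across the two halves exceed all of `D`.
  A : Subset
  A (+ a)    = G a
  A -[1+ b ] = ∃ λ c → b ≡ M ℕ.+ c × G c

  far∉D : ∀ a c → a ℕ.+ suc (M ℕ.+ c) ∉ D
  far∉D a c d∈ = ℕP.<⇒≱ (ℕP.≤-trans (s≤s (ℕP.m≤m+n M c)) (ℕP.m≤n+m (suc (M ℕ.+ c)) a))
                        (All.lookup (xs≤max 0 D) d∈)

  A-diff∉D : ∀ x y → A x → A y → x ≢ y → ∣ x ℤ.- y ∣ ∉ D
  A-diff∉D (+ a) (+ b) Ga Gb x≢y d∈ =
    G-⊖∉ Ga Gb (x≢y ∘ cong +_) (subst (λ z → ∣ z ∣ ∈ D) (ℤP.m-n≡m⊖n a b) d∈)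
  A-diff∉D (+ a) -[1+ _ ] Ga (c , refl , Gc) x≢y d∈ = far∉D a c d∈
  A-diff∉D x@(-[1+ _ ]) y@(+ b) (c , refl , Gc) Gb x≢y d∈ =
    far∉D b c (subst (_∈ D) (ℤP.∣i-j∣≡∣j-i∣ x y) d∈)
  A-diff∉D -[1+ _ ] -[1+ _ ] (c , refl , Gc) (e , refl , Ge) x≢y d∈ =
    -- Reflection reverses the order and the common shift by `M` cancels, so the difference is
    -- `e ⊖ c`.
    G-⊖∉ Ge Gc (λ { refl → x≢y refl })
      (subst (λ z → ∣ z ∣ ∈ D) (trans (ℤP.[1+m]⊖[1+n]≡m⊖n (M ℕ.+ e) (M ℕ.+ c)) (ℤP.+-cancelˡ-⊖ M e c)) d∈)

  reflect : ℕ → ℤ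
  reflect c = -[1+ M ℕ.+ c ]

  -- Points of `A` in `[-(M + m), M + m]`. The mirror image of `c` is `-(M + c + 1)`, which stays
  -- inside exactly when `c < m`; hence the two different stages.
  window : ℕ → List ℤ
  window m = map +_ (greedy (suc (M ℕ.+ m))) ++ map reflect (greedy m)

  window-unique : ∀ m → Unique (window m)
  window-unique m = UniqueP.++⁺
    (UniqueP.map⁺ ℤP.+-injective (greedy-unique (suc (M ℕ.+ m))))
    (UniqueP.map⁺ (ℕP.+-cancelˡ-≡ M _ _ ∘ ℤP.-[1+-injective) (greedy-unique m))
    (λ (p , q) → disjoint (∈-map⁻ +_ p) (∈-map⁻ reflect q))
    where
    disjoint : ∀ {v} {P Q : ℕ → Set} → ∃ (λ a → P a × v ≡ + a) → ¬ ∃ (λ c → Q c × v ≡ reflect c)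
    disjoint (_ , _ , refl) (_ , _ , ())

  window-bounded : ∀ m → All (λ x → A x × (- (+ (M ℕ.+ m))) ℤ.≤ x × x ℤ.≤ + (M ℕ.+ m)) (window m)
  window-bounded m = AllP.++⁺
    (AllP.map⁺ (All.tabulate λ {a} a∈ →
      ∈-greedy⇒G (suc (M ℕ.+ m)) a∈ , ℤP.neg-≤-pos {M ℕ.+ m} {a} , +≤+ (ℕP.≤-pred (∈-greedy⇒< (suc (M ℕ.+ m)) a∈))))
    (AllP.map⁺ (All.tabulate λ {c} c∈ →
      (c , refl , ∈-greedy⇒G m c∈) ,
      ℤP.neg-mono-≤ (+≤+ (subst (ℕ._≤ M ℕ.+ m) (ℕP.+-suc M c) (ℕP.+-monoʳ-≤ M (∈-greedy⇒< m c∈)))) ,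
      -≤+))

  -- The additive error `M` counts the integers from `-M` to `-1`, the gap between the two halves.
  window-length : ∀ m → suc (2 ℕ.* (M ℕ.+ m)) ℕ.≤ length (window m) ℕ.* suc (length D) ℕ.+ M
  window-length m = begin
    suc (2 ℕ.* (M ℕ.+ m))
      ≡⟨ regroup M m ⟩
    suc (M ℕ.+ m) ℕ.+ m ℕ.+ M
      ≤⟨ ℕP.+-monoˡ-≤ M (ℕP.+-mono-≤ (greedy-length (suc (M ℕ.+ m))) (greedy-length m)) ⟩
    length g₁ ℕ.* suc (length D) ℕ.+ length g₂ ℕ.* suc (length D) ℕ.+ M
      ≡⟨ cong (ℕ._+ M) (ℕP.*-distribʳ-+ (suc (length D)) (length g₁) (length g₂)) ⟨
    (length g₁ ℕ.+ length g₂) ℕ.* suc (length D) ℕ.+ M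
      ≡⟨ cong (λ l → l ℕ.* suc (length D) ℕ.+ M)
           (trans (ListP.length-++ (map +_ g₁))
                  (cong₂ ℕ._+_ (ListP.length-map +_ g₁) (ListP.length-map reflect g₂))) ⟨
    length (window m) ℕ.* suc (length D) ℕ.+ M ∎
    where
    open ℕP.≤-Reasoning
    g₁ = greedy (suc (M ℕ.+ m))
    g₂ = greedy m
    regroup : ∀ M m → suc (2 ℕ.* (M ℕ.+ m)) ≡ suc (M ℕ.+ m) ℕ.+ m ℕ.+ M
    regroup = solve-∀

  A-density : ∀ ε → 0ℚ ℚ.< ε → UpperDensityGE A ((+ 1) / suc (length D) ℚ.- ε)
  A-density ε ε>0 δ δ>0 N =
    n , N≤n , length (window m) ,
    (window m , window-unique m , refl , window-bounded m) ,
    ℚP.<-trans (p-ε<p _ δ>0) (p<r+δ⇒p-δ<r (ratio (length (window m)) n) ε close)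
    where
    -- The summand `N` puts the window past `N`; the other makes the gap of size `M` negligible
    -- against `ε`.
    m = N ℕ.+ M ℕ.* ℚ.↧ₙ ε
    n = M ℕ.+ m
    N≤n : N ℕ.≤ n
    N≤n = ℕP.≤-trans (ℕP.m≤m+n N _) (ℕP.m≤n+m m M)
    large : M ℕ.* ℚ.↧ₙ ε ℕ.< suc (length D) ℕ.* suc (2 ℕ.* n)
    large = begin-strict
      M ℕ.* ℚ.↧ₙ ε                     ≤⟨ ℕP.m≤n+m _ N ⟩
      m                                ≤⟨ ℕP.m≤n+m m M ⟩
      n                                ≤⟨ ℕP.m≤n*m n 2 ⟩
      2 ℕ.* n                          <⟨ ℕP.≤-refl ⟩
      suc (2 ℕ.* n)                    ≤⟨ ℕP.m≤n*m _ (suc (length D)) ⟩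
      suc (length D) ℕ.* suc (2 ℕ.* n) ∎
      where open ℕP.≤-Reasoning
    close : (+ 1) / suc (length D) ℚ.< ratio (length (window m)) n ℚ.+ ε
    close = /-<-/+ 1 (length D) (length (window m)) (2 ℕ.* n) M ε ε>0
      (subst (ℕ._≤ length (window m) ℕ.* suc (length D) ℕ.+ M) (sym (ℕP.*-identityˡ _)) (window-length m))
      large

-- From avoided differences to packing sets

differences : List ℤ → List ℕ
differences []       = []
differences (x ∷ xs) = map (λ y → ∣ x ℤ.- y ∣) xs ++ differences xs

∈-differences : ∀ {S s t} → s ∈ S → t ∈ S → s ≢ t → ∣ s ℤ.- t ∣ ∈ differences S
∈-differences (here refl) (here refl) s≢t = contradiction refl s≢t
∈-differences (here refl) (there t∈)  s≢t = ∈-++⁺ˡ (∈-map⁺ _ t∈)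
∈-differences {x ∷ xs} {s} {t} (there s∈) (here refl) s≢t =
  ∈-++⁺ˡ (subst (_∈ map (λ y → ∣ x ℤ.- y ∣) xs) (ℤP.∣i-j∣≡∣j-i∣ t s) (∈-map⁺ _ s∈))
∈-differences {x ∷ xs} (there s∈) (there t∈) s≢t =
  ∈-++⁺ʳ (map (λ y → ∣ x ℤ.- y ∣) xs) (∈-differences s∈ t∈ s≢t)

-- A collision `s + x = t + y` gives `t - s = x - y`, and `x ≢ y` forces `t ≢ s`, so `∣ x - y ∣`
-- would be a difference of `S`.
avoiding⇒packing : ∀ S {A : Subset} →
  (∀ x y → A x → A y → x ≢ y → ∣ x ℤ.- y ∣ ∉ differences S) → IsPacking S A
avoiding⇒packing S avoid x y Ax Ay x≢y s t s∈ t∈ s+x≡t+y =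
  avoid x y Ax Ay x≢y (subst (λ z → ∣ z ∣ ∈ differences S) t-s≡x-y (∈-differences t∈ s∈ t≢s))
  where
  t≢s : t ≢ s
  t≢s refl = x≢y (ℤG.∙-cancelˡ s x y s+x≡t+y)
  regroupˡ : ∀ s t y → t ℤ.- s ≡ (t ℤ.+ y) ℤ.- (s ℤ.+ y)
  regroupˡ = ℤSolver.solve-∀
  regroupʳ : ∀ s x y → (s ℤ.+ x) ℤ.- (s ℤ.+ y) ≡ x ℤ.- y
  regroupʳ = ℤSolver.solve-∀
  t-s≡x-y : t ℤ.- s ≡ x ℤ.- y
  t-s≡x-y = trans (regroupˡ s t y)
    (trans (cong (ℤ._- (s ℤ.+ y)) (sym s+x≡t+y)) (regroupʳ s x y))

packingDensity≥ : ∀ S → PackingDensityGE S ((+ 1) / suc (length (differences S)))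
packingDensity≥ S ε ε>0 = A , avoiding⇒packing S A-diff∉D , A-density ε ε>0
  where open Greedy (differences S)

four≥1/7 : ∀ S → length S ≡ 4 → PackingDensityGE S ((+ 1) / 7)
-- Four entries give 3 + 2 + 1 = 6 pairs, so the denominator computes to 7 once the shape of the
-- list is exposed.
four≥1/7 S@(_ ∷ _ ∷ _ ∷ _ ∷ []) refl = packingDensity≥ S

-- The packing density of {0,1,4,6}

S₀-gap : ∀ {A} → IsPacking S₀ A → ∀ {x} j → A x → A (+ suc j ℤ.+ x) → 6 ℕ.≤ j
S₀-gap {A} packing {x} j Ax Ay = go j Ay
  where
  shift≢ : ∀ j → + suc j ℤ.+ x ≢ x
  shift≢ j eq with ℤG.∙-cancelʳ x (+ suc j) (+ 0) (trans eq (sym (ℤP.+-identityˡ x)))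
  ... | ()
  0∈ : + 0 ∈ S₀
  0∈ = here refl
  1∈ : + 1 ∈ S₀
  1∈ = there (here refl)
  4∈ : + 4 ∈ S₀
  4∈ = there (there (here refl))
  6∈ : + 6 ∈ S₀
  6∈ = there (there (there (here refl)))
  -- The translates by `suc j + x` and by `x` share the point `s + suc j + x`.
  clash : ∀ j s → + s ∈ S₀ → + (s ℕ.+ suc j) ∈ S₀ → ¬ A (+ suc j ℤ.+ x)
  clash j s s∈ t∈ Ay = packing (+ suc j ℤ.+ x) x Ay Ax (shift≢ j) (+ s) (+ (s ℕ.+ suc j)) s∈ t∈
    (sym (ℤP.+-assoc (+ s) (+ suc j) x))
  -- `S₀` is a perfect Golomb ruler: each of 1, ..., 6 is the difference of exactly one pair, named
  -- in the matching clause.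
  go : ∀ j → A (+ suc j ℤ.+ x) → 6 ℕ.≤ j
  go 0 Ay = contradiction Ay (clash 0 0 0∈ 1∈)
  go 1 Ay = contradiction Ay (clash 1 4 4∈ 6∈)
  go 2 Ay = contradiction Ay (clash 2 1 1∈ 4∈)
  go 3 Ay = contradiction Ay (clash 3 0 0∈ 4∈)
  go 4 Ay = contradiction Ay (clash 4 1 1∈ 6∈)
  go 5 Ay = contradiction Ay (clash 5 0 0∈ 6∈)
  go (suc (suc (suc (suc (suc (suc j)))))) _ = s≤s (s≤s (s≤s (s≤s (s≤s (s≤s z≤n)))))

/7-≡⇒∸≤6 : ∀ u v → u DM./ 7 ≡ v DM./ 7 → v ∸ u ℕ.≤ 6
/7-≡⇒∸≤6 u v eq = ℕP.m≤n+o⇒m∸n≤o v u (begin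
  v                             ≡⟨ DM.m≡m%n+[m/n]*n v 7 ⟩
  v DM.% 7 ℕ.+ (v DM./ 7) ℕ.* 7 ≤⟨ ℕP.+-monoˡ-≤ _ (ℕP.≤-pred (DM.m%n<n v 7)) ⟩
  6 ℕ.+ (v DM./ 7) ℕ.* 7        ≡⟨ cong (λ q → 6 ℕ.+ q ℕ.* 7) eq ⟨
  6 ℕ.+ (u DM./ 7) ℕ.* 7        ≤⟨ ℕP.+-monoʳ-≤ 6 (DM.m/n*n≤m u 7) ⟩
  6 ℕ.+ u                       ≡⟨ ℕP.+-comm 6 u ⟩
  u ℕ.+ 6                       ∎)
  where open ℕP.≤-Reasoning

module Blocks {A : Subset} (packing : IsPacking S₀ A) (n : ℕ) where

  InWindow : ℤ → Set
  InWindow x = A x × (- (+ n)) ℤ.≤ x × x ℤ.≤ + n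

  -- Moves `[-n,n]` to `[0,2n]`, where division by 7 cuts out the blocks; the absolute value changes
  -- nothing on the window.
  offset : ℤ → ℕ
  offset x = ∣ x ℤ.+ + n ∣

  block : ℤ → ℕ
  block x = offset x DM./ 7

  +offset : ∀ {x} → InWindow x → + offset x ≡ x ℤ.+ + n
  +offset {x} (_ , lo , _) = ℤP.0≤i⇒+∣i∣≡i
    (subst (ℤ._≤ x ℤ.+ + n) (ℤP.+-inverseˡ (+ n)) (ℤP.+-monoˡ-≤ (+ n) lo))

  -- Points in one block differ by some `d ≤ 6`. Distinctness rules out `d = 0`, and `S₀-gap` rules
  -- out 1, ..., 6.
  ordered⇒block-≢ : ∀ {x y} → InWindow x → InWindow y → x ≢ y →
                    offset x ℕ.≤ offset y → block x ≢ block y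
  ordered⇒block-≢ {x} {y} wx wy x≢y u≤v eq =
    split (offset y ∸ offset x) y≡d+x (/7-≡⇒∸≤6 (offset x) (offset y) eq)
    where
    y≡d+x : y ≡ + (offset y ∸ offset x) ℤ.+ x
    y≡d+x = ℤG.∙-cancelʳ (+ n) _ _ (begin
      y ℤ.+ + n                                   ≡⟨ +offset wy ⟨
      + offset y                                  ≡⟨ cong +_ (ℕP.m∸n+n≡m u≤v) ⟨
      + (offset y ∸ offset x) ℤ.+ + offset x      ≡⟨ cong (ℤ._+_ (+ (offset y ∸ offset x))) (+offset wx) ⟩
      + (offset y ∸ offset x) ℤ.+ (x ℤ.+ + n)     ≡⟨ ℤP.+-assoc (+ (offset y ∸ offset x)) x (+ n) ⟨
      + (offset y ∸ offset x) ℤ.+ x ℤ.+ + n       ∎)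
      where open ≡-Reasoning
    split : ∀ d → y ≡ + d ℤ.+ x → ¬ d ℕ.≤ 6
    split zero    y≡ _ = x≢y (sym (trans y≡ (ℤP.+-identityˡ x)))
    split (suc j) y≡ j<6 =
      ℕP.<⇒≱ j<6 (S₀-gap packing j (proj₁ wx) (subst A y≡ (proj₁ wy)))

  block-≢ : ∀ {x y} → InWindow x → InWindow y → x ≢ y → block x ≢ block y
  block-≢ {x} {y} wx wy x≢y with ℕP.≤-total (offset x) (offset y)
  ... | inj₁ u≤v = ordered⇒block-≢ wx wy x≢y u≤v
  ... | inj₂ v≤u = ordered⇒block-≢ wy wx (x≢y ∘ sym) v≤u ∘ sym

  block-< : ∀ {x} → InWindow x → block x ℕ.< suc ((n ℕ.+ n) DM./ 7)
  block-< {x} w@(_ , _ , hi) = s≤s (DM./-monoˡ-≤ 7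
    (ℤP.drop‿+≤+ (subst (ℤ._≤ + (n ℕ.+ n)) (sym (+offset w)) (ℤP.+-monoˡ-≤ (+ n) hi))))

  -- `block` is injective on the listed points and takes at most `⌊2n/7⌋ + 1` values. Multiplying by
  -- 7 gives at most `2n + 7`; the excess 6 over `2n + 1` pays for an incomplete last block.
  count≤ : ∀ {k} → AtLeast A n k → k ℕ.* 7 ℕ.≤ 1 ℕ.* suc (2 ℕ.* n) ℕ.+ 6
  count≤ (xs , unique , refl , inWindow) = begin
    length xs ℕ.* 7
      ≤⟨ ℕP.*-monoˡ-≤ 7 k≤ ⟩
    suc ((n ℕ.+ n) DM./ 7) ℕ.* 7
      ≤⟨ ℕP.+-monoʳ-≤ 7 (DM.m/n*n≤m (n ℕ.+ n) 7) ⟩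
    7 ℕ.+ (n ℕ.+ n)
      ≡⟨ regroup n ⟩
    1 ℕ.* suc (2 ℕ.* n) ℕ.+ 6 ∎
    where
    open ℕP.≤-Reasoning
    regroup : ∀ n → 7 ℕ.+ (n ℕ.+ n) ≡ 1 ℕ.* suc (2 ℕ.* n) ℕ.+ 6
    regroup = solve-∀
    in-range : ∀ {b} → b ∈ map block xs → b ∈ upTo (suc ((n ℕ.+ n) DM./ 7))
    in-range b∈ with ∈-map⁻ block b∈
    ... | _ , x∈ , refl = ∈-upTo⁺ (block-< (All.lookup inWindow x∈))
    k≤ : length xs ℕ.≤ suc ((n ℕ.+ n) DM./ 7)
    k≤ = subst₂ ℕ._≤_ (ListP.length-map block xs) (ListP.length-upTo _)
           (Unique-⊆⇒length-≤ (Unique-map block block-≢ inWindow unique) in-range)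

S₀≤1/7 : PackingDensityLE S₀ ((+ 1) / 7)
S₀≤1/7 A packing δ δ>0 = 6 ℕ.* ℚ.↧ₙ δ , λ n N≤n k atLeast →
  -- The first 6 encodes the denominator 7; the second is the rounding error from `count≤`, absorbed
  -- by the threshold `6 * ↧ₙ δ`.
  /-<-/+ k (2 ℕ.* n) 1 6 6 δ δ>0 (Blocks.count≤ packing n atLeast) (large n N≤n)
  where
  large : ∀ n → 6 ℕ.* ℚ.↧ₙ δ ℕ.≤ n → 6 ℕ.* ℚ.↧ₙ δ ℕ.< suc (2 ℕ.* n) ℕ.* 7
  large n N≤n = ℕP.≤-trans (s≤s (ℕP.≤-trans N≤n (ℕP.m≤n*m n 2))) (ℕP.m≤m*n (suc (2 ℕ.* n)) 7)

mainTheorem1 : ((S : List ℤ) → Unique S → length S ≡ 4 → PackingDensityGE S ((+ 1) / 7))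
    × PackingDensityEq S₀ ((+ 1) / 7)
mainTheorem1 = (λ S _ → four≥1/7 S) , four≥1/7 S₀ refl , S₀≤1/7
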